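{- Let $r\ge 3$, $k\ge 2$ be integers and let $n\ge (r-1)k+1+\binom{(r-1)k-1}{r-1}$ be an integer with $k\mid n$. Then there exists an integer $m$ with $1\le m<k$ such that $$T\big(n,K_{(r-1)k+1}^{(r)};k\big)\ge T\big(n,K_{(r-1)k+1}^{(r)};m\big).$$
   Context: An $r$-graph is a pair $H=(V,E)$ with $V$ a finite vertex set and $E$ a set of $r$-element subsets of $V$; connected components are in the usual sense (isolated vertices count as components). For integers $K>r$, say an $r$-graph satisfies the covering condition for $K$ if every $K$-element subset of its vertex set contains at least one edge. For an integer $m\ge1$, $T(n,K_K^{(r)};m)$ denotes the smallest integer $t$ such that there exists an $r$-graph with $n$ vertices, $t$ edges and exactly $m$ connected components satisfying the covering condition for $K$. -}

module Defs where

open import Data.Nat using (ℕ; _≤_)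
open import Data.Fin using (Fin)
open import Data.Fin.Subset using (Subset; _∈_; _⊆_; ∣_∣)
open import Data.List using (List; length)
open import Data.List.Relation.Unary.All using (All)
open import Data.List.Relation.Unary.Unique.Propositional using (Unique)
import Data.List.Membership.Propositional as L
open import Data.Product using (Σ; ∃; _×_)
open import Relation.Binary.PropositionalEquality using (_≡_)
open import Relation.Binary.Construct.Closure.ReflexiveTransitive using (Star)

record RGraph (r n : ℕ) : Set where
  field
    edges    : List (Subset n)
    uniform  : All (λ e → ∣ e ∣ ≡ r) edges
    distinct : Unique edges
open RGraph public

numEdges : ∀ {r n} → RGraph r n → ℕ
numEdges H = length (edges H)

Adj : ∀ {r n} → RGraph r n → Fin n → Fin n → Set
Adj H u v = ∃ λ e → e L.∈ edges H × (u ∈ e × v ∈ e)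

Connected : ∀ {r n} → RGraph r n → Fin n → Fin n → Set
Connected H = Star (Adj H)

HasComponents : ∀ {r n} → RGraph r n → ℕ → Set
HasComponents {n = n} H m =
  Σ (Fin n → Fin m) λ c →
    (∀ j → ∃ λ u → c u ≡ j) ×
    (∀ u v → (c u ≡ c v → Connected H u v) × (Connected H u v → c u ≡ c v))

Covering : ∀ {r n} → RGraph r n → ℕ → Set
Covering {n = n} H K = ∀ (S : Subset n) → ∣ S ∣ ≡ K → ∃ λ e → e L.∈ edges H × e ⊆ S

Admissible : ∀ {r n} → ℕ → ℕ → RGraph r n → Set
Admissible K m H = HasComponents H m × Covering H K

IsT : ℕ → ℕ → ℕ → ℕ → ℕ → Set
IsT r n K m t =
  (∃ λ (H : RGraph r n) → Admissible K m H × numEdges H ≡ t) ×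
  (∀ (H : RGraph r n) → Admissible K m H → t ≤ numEdges H)

{-# OPTIONS --safe #-}
module Submission where

-- One can always take m = k - 1: an admissible graph H with k components yields one with k - 1
-- components and no more edges.
-- If H has an isolated vertex v, the lower bound on n forces, via a maximal independent set and the
-- pigeonhole principle, two edges f ≠ g sharing vertices x ≠ y. Replacing f by f - x + v preserves the
-- covering condition, and g keeps x attached, so the only effect on components is that v joins them.
-- If H has no isolated vertex, every component contains an independent (r-1)-set, so a set with r - 1
-- vertices from each component and one more vertex forces all components to be complete. Take a, a′ in
-- a component with more than r vertices and b, b′ in another one, and in every edge containing exactly
-- one vertex of such a pair interchange a with b and a′ with b′. This permutes the r-sets, preserves
-- the covering condition and joins the two components.

open import Defs
open import Data.Bool using (Bool; true; false; if_then_else_; _xor_; _∨_)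
open import Data.Bool.Properties using (∨-comm; xor-comm) renaming (_≟_ to _≟ᵇ_)
open import Data.Fin using (Fin; zero; suc; punchIn; punchOut)
open import Data.Fin.Permutation.Components using (transpose; transpose-inverse)
open import Data.Fin.Properties as Fin using (_≟_; any?; pigeonhole; punchInᵢ≢i; punchOut-cong;
  punchOut-injective; punchOut-punchIn)
open import Data.Fin.Subset
open import Data.Fin.Subset.Properties
open import Data.List using (List; []; _∷_; length; map; filter; allFin) renaming (_++_ to _++ˡ_)
open import Data.List.Properties using (length-map; length-++; length-tabulate; filter-notAll)
open import Data.List.Membership.Propositional using (find; lose) renaming (_∈_ to _∈ˡ_)
open import Data.List.Membership.Propositional.Properties using (∈-map⁺; ∈-map⁻; ∈-++⁺ˡ; ∈-++⁺ʳ;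
  ∈-filter⁺; ∈-filter⁻; ∈-allFin)
import Data.List.Relation.Unary.All as All
import Data.List.Relation.Unary.All.Properties as All
open import Data.List.Relation.Unary.Any as Any using (here; there)
open import Data.List.Relation.Unary.Any.Properties using (lookup-index)
import Data.List.Relation.Unary.AllPairs as AllPairs
open import Data.List.Relation.Unary.Unique.Propositional using (Unique)
import Data.List.Relation.Unary.Unique.Propositional.Properties as Unique
open import Data.Nat using (ℕ; zero; suc; _+_; _*_; _∸_; _≤_; _<_; z≤n; s≤s; s≤s⁻¹)
open import Data.Nat.Combinatorics using (_C_; nCk+nC[k+1]≡[n+1]C[k+1]; nC1≡n; nCn≡1)
open import Data.Nat.Divisibility using (_∣_)
open import Data.Nat.Properties using (≤-refl; ≤-reflexive; ≤-trans; ≤-antisym; <⇒≱; <-irrefl;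
  n≤1+n; +-assoc; +-comm; +-suc; +-mono-≤; +-monoʳ-≤; *-comm; *-identityˡ; *-mono-≤; *-suc;
  m∸n+n≡m; m≤n+m; suc-injective; module ≤-Reasoning)
open import Data.Product using (Σ; ∃; _×_; _,_; proj₁; proj₂)
open import Data.Sum using (_⊎_; inj₁; inj₂; [_,_]′)
open import Data.Vec using (_∷_; []; lookup; tabulate; here; there)
open import Data.Vec.Properties using (lookup⇒[]=; []=⇒lookup; lookup∘tabulate; ≡-dec)
open import Function using (_∘_; id; case_of_)
open import Relation.Binary.Construct.Closure.ReflexiveTransitive using (ε; _◅_; _◅◅_; reverse)
open import Relation.Binary.PropositionalEquality using (_≡_; _≢_; refl; sym; trans; cong; cong₂; subst)
open import Relation.Nullary using (¬_; Dec; yes; no; contradiction; ¬?)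
open import Relation.Nullary.Decidable using (dec-true; dec-false; _×-dec_)

-- Cardinalities of finite subsets

x∉p-x : ∀ {n} {x} (p : Subset n) → x ∉ p - x
x∉p-x {x = zero} (true ∷ p) ()
x∉p-x {x = zero} (false ∷ p) ()
x∉p-x {x = suc x} (s ∷ p) (there x∈) = x∉p-x p x∈

p-x⊆p : ∀ {n} {x} {p : Subset n} → p - x ⊆ p
p-x⊆p {x = x} {p} = p─q⊆p p ⁅ x ⁆

∈-≢ : ∀ {n} {x y : Fin n} {p : Subset n} → x ∈ p → y ∉ p → x ≢ y
∈-≢ x∈p y∉p refl = y∉p x∈p

∣p-x∣+1 : ∀ {n} {x} {p : Subset n} → x ∈ p → suc ∣ p - x ∣ ≡ ∣ p ∣
∣p-x∣+1 {p = true ∷ p} here = cong (suc ∘ ∣_∣) (p─⊥≡p p)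
∣p-x∣+1 {p = true ∷ p} (there x∈p) = cong suc (∣p-x∣+1 x∈p)
∣p-x∣+1 {p = false ∷ p} (there x∈p) = ∣p-x∣+1 x∈p

∣p∪q∣-disjoint : ∀ {n} {p q : Subset n} → (∀ {x} → x ∈ p → x ∉ q) → ∣ p ∪ q ∣ ≡ ∣ p ∣ + ∣ q ∣
∣p∪q∣-disjoint {p = []} {[]} disj = refl
∣p∪q∣-disjoint {p = true ∷ p} {true ∷ q} disj = contradiction here (disj here)
∣p∪q∣-disjoint {p = true ∷ p} {false ∷ q} disj =
  cong suc (∣p∪q∣-disjoint (λ x∈p x∈q → disj (there x∈p) (there x∈q)))
∣p∪q∣-disjoint {p = false ∷ p} {true ∷ q} disj =
  trans (cong suc (∣p∪q∣-disjoint (λ x∈p x∈q → disj (there x∈p) (there x∈q)))) (sym (+-suc ∣ p ∣ ∣ q ∣))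
∣p∪q∣-disjoint {p = false ∷ p} {false ∷ q} disj =
  ∣p∪q∣-disjoint (λ x∈p x∈q → disj (there x∈p) (there x∈q))

∣p∪⁅x⁆∣ : ∀ {n} {x} {p : Subset n} → x ∉ p → ∣ p ∪ ⁅ x ⁆ ∣ ≡ suc ∣ p ∣
∣p∪⁅x⁆∣ {x = x} {p} x∉p = trans
  (∣p∪q∣-disjoint λ y∈p y∈x → x∉p (subst (_∈ p) (x∈⁅y⁆⇒x≡y x y∈x) y∈p))
  (trans (cong (∣ p ∣ +_) (∣⁅x⁆∣≡1 x)) (+-comm ∣ p ∣ 1))

-- Induction on `p`: the image of the first element is removed from `q`, and injectivity keeps the
-- remaining images away from it.
injective⇒∣p∣≤∣q∣ : ∀ {m n} (p : Subset m) (q : Subset n) (f : Fin m → Fin n) →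
  (∀ {x y} → f x ≡ f y → x ≡ y) → (∀ {x} → x ∈ p → f x ∈ q) → ∣ p ∣ ≤ ∣ q ∣
injective⇒∣p∣≤∣q∣ [] q f f-inj f-∈ = z≤n
injective⇒∣p∣≤∣q∣ (true ∷ p) q f f-inj f-∈ =
  subst (suc ∣ p ∣ ≤_) (∣p-x∣+1 (f-∈ here)) (s≤s (injective⇒∣p∣≤∣q∣ p (q - f zero) (f ∘ suc)
    (Fin.suc-injective ∘ f-inj)
    (λ x∈p → x∈p∧x≢y⇒x∈p-y (f-∈ (there x∈p)) (λ eq → case f-inj eq of λ ()))))
injective⇒∣p∣≤∣q∣ (false ∷ p) q f f-inj f-∈ =
  injective⇒∣p∣≤∣q∣ p q (f ∘ suc) (Fin.suc-injective ∘ f-inj) (f-∈ ∘ there)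

⊆∧∣q∣≤∣p∣⇒≡ : ∀ {n} {p q : Subset n} → p ⊆ q → ∣ q ∣ ≤ ∣ p ∣ → p ≡ q
⊆∧∣q∣≤∣p∣⇒≡ {p = p} p⊆q q≤p = ⊆-antisym p⊆q λ {x} x∈q → case x ∈? p of λ where
  (yes x∈p) → x∈p
  (no x∉p) → contradiction q≤p (<⇒≱ (p⊂q⇒∣p∣<∣q∣ (p⊆q , x , x∈q , x∉p)))

∣p∣>0⇒nonempty : ∀ {n} (p : Subset n) → 1 ≤ ∣ p ∣ → Nonempty p
∣p∣>0⇒nonempty (true ∷ p) _ = zero , here
∣p∣>0⇒nonempty (false ∷ p) 1≤p with ∣p∣>0⇒nonempty p 1≤p
... | x , x∈p = suc x , there x∈p

-- The free `d` admits the bounds `2 ≤` and `3 ≤` alike.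
another : ∀ {n d} {x} {p : Subset n} → suc (suc d) ≤ ∣ p ∣ → x ∈ p → ∃ λ y → y ∈ p × y ≢ x
another {x = x} {p} 2≤p x∈p
  with ∣p∣>0⇒nonempty (p - x) (≤-trans (s≤s z≤n) (s≤s⁻¹ (subst (_ ≤_) (sym (∣p-x∣+1 x∈p)) 2≤p)))
... | y , y∈ = y , p-x⊆p y∈ , λ { refl → x∉p-x p y∈ }

two-more : ∀ {n} {x} {p : Subset n} → 3 ≤ ∣ p ∣ → x ∈ p →
  ∃ λ y → ∃ λ z → y ∈ p × z ∈ p × y ≢ x × z ≢ x × y ≢ z
two-more {x = x} {p} 3≤p x∈p with another 3≤p x∈p
... | y , y∈p , y≢x
  with another (s≤s⁻¹ (subst (3 ≤_) (sym (∣p-x∣+1 x∈p)) 3≤p)) (x∈p∧x≢y⇒x∈p-y y∈p y≢x)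
... | z , z∈ , z≢y = y , z , y∈p , p-x⊆p z∈ , y≢x , (λ { refl → x∉p-x p z∈ }) , z≢y ∘ sym

-- Preimages and transpositions

preimage : ∀ {m n} → (Fin m → Fin n) → Subset n → Subset m
preimage f p = tabulate (lookup p ∘ f)

∈-preimage⁺ : ∀ {m n} (f : Fin m → Fin n) {p x} → f x ∈ p → x ∈ preimage f p
∈-preimage⁺ f {p} {x} fx∈p =
  lookup⇒[]= x _ (trans (lookup∘tabulate (lookup p ∘ f) x) ([]=⇒lookup fx∈p))

∈-preimage⁻ : ∀ {m n} (f : Fin m → Fin n) {p x} → x ∈ preimage f p → f x ∈ p
∈-preimage⁻ f {p} {x} x∈ =
  lookup⇒[]= (f x) p (trans (sym (lookup∘tabulate (lookup p ∘ f) x)) ([]=⇒lookup x∈))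

∣preimage∣ : ∀ {n} (f g : Fin n → Fin n) → (∀ x → g (f x) ≡ x) → (∀ x → f (g x) ≡ x) →
  ∀ p → ∣ preimage f p ∣ ≡ ∣ p ∣
∣preimage∣ f g gf fg p = ≤-antisym
  (injective⇒∣p∣≤∣q∣ (preimage f p) p f
    (λ {x} {y} eq → trans (sym (gf x)) (trans (cong g eq) (gf y))) (∈-preimage⁻ f))
  (injective⇒∣p∣≤∣q∣ p (preimage f p) g
    (λ {x} {y} eq → trans (sym (fg x)) (trans (cong f eq) (fg y)))
    (λ {x} x∈p → ∈-preimage⁺ f (subst (_∈ p) (sym (fg x)) x∈p)))

transpose-ˡ : ∀ {n} (x y : Fin n) → transpose x y x ≡ y
transpose-ˡ x y rewrite dec-true (x ≟ x) refl = refl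

transpose-ʳ : ∀ {n} (x y : Fin n) → transpose x y y ≡ x
transpose-ʳ x y with y ≟ x
... | yes y≡x = y≡x
... | no _ rewrite dec-true (y ≟ y) refl = refl

transpose-≢ : ∀ {n} {x y z : Fin n} → z ≢ x → z ≢ y → transpose x y z ≡ z
transpose-≢ {x = x} {y} {z} z≢x z≢y rewrite dec-false (z ≟ x) z≢x | dec-false (z ≟ y) z≢y = refl

-- For `x ∈ p` and `y ∉ p`, the only case in use, this is p - x + y. As a preimage under a
-- permutation it keeps the size of `p` without any case distinction.
exchange : ∀ {n} → Fin n → Fin n → Subset n → Subset n
exchange x y = preimage (transpose x y)

∣exchange∣ : ∀ {n} (x y : Fin n) p → ∣ exchange x y p ∣ ≡ ∣ p ∣
∣exchange∣ x y = ∣preimage∣ (transpose x y) (transpose y x)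
  (λ _ → transpose-inverse y x) (λ _ → transpose-inverse x y)

∈-exchange-new : ∀ {n} {x y : Fin n} {p} → x ∈ p → y ∈ exchange x y p
∈-exchange-new {x = x} {y} {p} x∈p =
  ∈-preimage⁺ (transpose x y) (subst (_∈ p) (sym (transpose-ʳ x y)) x∈p)

∈-exchange-old : ∀ {n} {x y z : Fin n} {p} → z ∈ p → z ≢ x → y ∉ p → z ∈ exchange x y p
∈-exchange-old {x = x} {y} {p = p} z∈p z≢x y∉p =
  ∈-preimage⁺ (transpose x y) (subst (_∈ p) (sym (transpose-≢ z≢x (∈-≢ z∈p y∉p))) z∈p)

∈-exchange⁻ : ∀ {n} {x y z : Fin n} {p} → y ∉ p → z ∈ exchange x y p → z ≡ y ⊎ (z ∈ p × z ≢ x)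
∈-exchange⁻ {x = x} {y} {z} {p} y∉p z∈ with z ≟ y
... | yes z≡y = inj₁ z≡y
... | no z≢y = inj₂ (subst (_∈ p) (transpose-≢ z≢x z≢y) (∈-preimage⁻ (transpose x y) z∈) , z≢x)
  where
  z≢x : z ≢ x
  z≢x refl = y∉p (subst (_∈ p) (transpose-ˡ x y) (∈-preimage⁻ (transpose x y) z∈))

-- Subsets of given size and the pigeonhole principle

choose : ∀ {n} → Subset n → ℕ → List (Subset n)
choose [] zero = [] ∷ []
choose [] (suc j) = []
choose (false ∷ p) j = map (false ∷_) (choose p j)
choose (true ∷ p) zero = map (false ∷_) (choose p zero)
choose (true ∷ p) (suc j) = map (true ∷_) (choose p j) ++ˡ map (false ∷_) (choose p (suc j))

∈-choose : ∀ {n} (p q : Subset n) → q ⊆ p → q ∈ˡ choose p ∣ q ∣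
∈-choose [] [] q⊆p = here refl
∈-choose (false ∷ p) (true ∷ q) q⊆p = case q⊆p here of λ ()
∈-choose (false ∷ p) (false ∷ q) q⊆p = ∈-map⁺ (false ∷_) (∈-choose p q (drop-∷-⊆ q⊆p))
∈-choose (true ∷ p) (true ∷ q) q⊆p = ∈-++⁺ˡ (∈-map⁺ (true ∷_) (∈-choose p q (drop-∷-⊆ q⊆p)))
∈-choose (true ∷ p) (false ∷ q) q⊆p with ∣ q ∣ | ∈-choose p q (drop-∷-⊆ q⊆p)
... | zero | q∈ = ∈-map⁺ (false ∷_) q∈
... | suc j | q∈ = ∈-++⁺ʳ (map (true ∷_) (choose p j)) (∈-map⁺ (false ∷_) q∈)

length-choose : ∀ {n} (p : Subset n) j → length (choose p j) ≡ ∣ p ∣ C j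
length-choose [] zero = refl
length-choose [] (suc j) = refl
length-choose (false ∷ p) j = trans (length-map _ (choose p j)) (length-choose p j)
length-choose (true ∷ p) zero = trans (length-map _ (choose p 0)) (length-choose p 0)
length-choose (true ∷ p) (suc j) = trans
  (length-++ (map (true ∷_) (choose p j)))
  (trans (cong₂ _+_ (trans (length-map _ (choose p j)) (length-choose p j))
                    (trans (length-map _ (choose p (suc j))) (length-choose p (suc j))))
         (nCk+nC[k+1]≡[n+1]C[k+1] ∣ p ∣ j))

C-monoˡ-suc : ∀ n j → n C j ≤ suc n C j
C-monoˡ-suc n zero = ≤-refl
C-monoˡ-suc n (suc j) = subst (n C suc j ≤_) (nCk+nC[k+1]≡[n+1]C[k+1] n j) (m≤n+m _ _)

C-monoˡ-+ : ∀ d n j → n C j ≤ (d + n) C j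
C-monoˡ-+ zero n j = ≤-refl
C-monoˡ-+ (suc d) n j = ≤-trans (C-monoˡ-+ d n j) (C-monoˡ-suc (d + n) j)

-- By Pascal's rule, each increase of `d` adds a binomial coefficient with lower entry j - 1, which
-- is at least 1.
d<[d+j]Cj : ∀ d j → 1 ≤ j → suc d ≤ (d + j) C j
d<[d+j]Cj zero j 1≤j = ≤-reflexive (sym (nCn≡1 j))
d<[d+j]Cj (suc d) (suc j) 1≤j = subst (suc (suc d) ≤_) (nCk+nC[k+1]≡[n+1]C[k+1] (d + suc j) j)
  (+-mono-≤ (subst (_≤ (d + suc j) C j) (nCn≡1 j)
    (subst (λ i → j C j ≤ i C j) (sym (+-suc d j)) (C-monoˡ-+ (suc d) j j)))
    (d<[d+j]Cj d (suc j) 1≤j))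

pigeonhole-∈ : ∀ {A : Set} {n} (xs : List A) (g : Fin n → A) → (∀ i → g i ∈ˡ xs) → length xs < n →
  ∃ λ i → ∃ λ j → i ≢ j × g i ≡ g j
pigeonhole-∈ xs g g∈xs xs<n with pigeonhole xs<n (λ i → Any.index (g∈xs i))
... | i , j , i<j , eq = i , j , Fin.<⇒≢ i<j ,
  trans (lookup-index (g∈xs i)) (trans (cong (Data.List.lookup xs) eq) (sym (lookup-index (g∈xs j))))

-- Connectivity

adj⇒connected : ∀ {r n} (H : RGraph r n) {e u w} → e ∈ˡ edges H → u ∈ e → w ∈ e → Connected H u w
adj⇒connected H e∈H u∈e w∈e = (_ , e∈H , u∈e , w∈e) ◅ ε

connected-sym : ∀ {r n} (H : RGraph r n) {u w} → Connected H u w → Connected H w u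
connected-sym H = reverse λ (e , e∈H , u∈e , w∈e) → e , e∈H , w∈e , u∈e

Monochromatic : ∀ {r n k} → RGraph r n → (Fin n → Fin k) → Set
Monochromatic H c = ∀ {e} → e ∈ˡ edges H → ∀ {u w} → u ∈ e → w ∈ e → c u ≡ c w

components-monochromatic : ∀ {r n k} (H : RGraph r n) (comps : HasComponents H k) →
  Monochromatic H (proj₁ comps)
components-monochromatic H (_ , _ , c-conn) e∈H u∈e w∈e =
  proj₂ (c-conn _ _) (adj⇒connected H e∈H u∈e w∈e)

module _ {m : ℕ} {i j : Fin (suc m)} (i≢j : i ≢ j) where

  -- The quotient map gluing `j` to `i`: `j` takes the value of `i`, and `punchOut` closes the gap
  -- left by `j`.
  identify : Fin (suc m) → Fin m
  identify x with j ≟ x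
  ... | yes _ = punchOut (i≢j ∘ sym)
  ... | no j≢x = punchOut j≢x

  identify-≡ : ∀ {x} → x ≡ i ⊎ x ≡ j → identify x ≡ punchOut (i≢j ∘ sym)
  identify-≡ {x} x∈ with j ≟ x
  identify-≡ {x} x∈ | yes _ = refl
  identify-≡ {x} (inj₁ x≡i) | no j≢x = punchOut-cong j x≡i
  identify-≡ {x} (inj₂ x≡j) | no j≢x = contradiction (sym x≡j) j≢x

  identify-punchIn : ∀ y → identify (punchIn j y) ≡ y
  identify-punchIn y with j ≟ punchIn j y
  ... | yes eq = contradiction (sym eq) (punchInᵢ≢i j y)
  ... | no _ = trans (punchOut-cong j refl) (punchOut-punchIn j)

  identify-injective : ∀ {x y} → identify x ≡ identify y →
    x ≡ y ⊎ (x ≡ i × y ≡ j) ⊎ (x ≡ j × y ≡ i)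
  identify-injective {x} {y} eq with j ≟ x | j ≟ y
  ... | yes j≡x | yes j≡y = inj₁ (trans (sym j≡x) j≡y)
  ... | yes j≡x | no j≢y = inj₂ (inj₂ (sym j≡x , sym (punchOut-injective _ j≢y eq)))
  ... | no j≢x | yes j≡y = inj₂ (inj₁ (punchOut-injective j≢x _ eq , sym j≡y))
  ... | no j≢x | no j≢y = inj₁ (punchOut-injective j≢x j≢y eq)

-- The first condition on edges keeps each old component connected in `H′`, and the path from `u₀`
-- to `w₀` joins two of them. The second makes the glued colouring constant on edges of `H′`, so
-- nothing else is joined.
merge-components : ∀ {r n m} (H H′ : RGraph r n) (comps : HasComponents H (suc m)) →
  let c = proj₁ comps in
  (u₀ w₀ : Fin n) → c u₀ ≢ c w₀ → Connected H′ u₀ w₀ →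
  (∀ {u w} → Adj H u w → Connected H′ u w) →
  (∀ {u w} → Adj H′ u w →
    c u ≡ c w ⊎ ((c u ≡ c u₀ ⊎ c u ≡ c w₀) × (c w ≡ c u₀ ⊎ c w ≡ c w₀))) →
  HasComponents H′ m
merge-components {n = n} {m} H H′ (c , c-surj , c-conn) u₀ w₀ i≢j u₀~w₀ H⇒H′ H′⇒c =
  c′ , c′-surj , λ u w → ≡⇒connected u w , connected⇒≡
  where
  c′ : Fin n → Fin m
  c′ = identify i≢j ∘ c

  c′-surj : ∀ y → ∃ λ u → c′ u ≡ y
  c′-surj y with c-surj (punchIn (c w₀) y)
  ... | u , eq = u , trans (cong (identify i≢j) eq) (identify-punchIn i≢j y)

  lift : ∀ {u w} → c u ≡ c w → Connected H′ u w
  lift eq = go (proj₁ (c-conn _ _) eq)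
    where
    go : ∀ {u w} → Connected H u w → Connected H′ u w
    go ε = ε
    go (a ◅ as) = H⇒H′ a ◅◅ go as

  ≡⇒connected : ∀ u w → c′ u ≡ c′ w → Connected H′ u w
  ≡⇒connected u w eq with identify-injective i≢j eq
  ... | inj₁ cu≡cw = lift cu≡cw
  ... | inj₂ (inj₁ (cu≡i , cw≡j)) = lift cu≡i ◅◅ u₀~w₀ ◅◅ lift (sym cw≡j)
  ... | inj₂ (inj₂ (cu≡j , cw≡i)) = lift cu≡j ◅◅ connected-sym H′ u₀~w₀ ◅◅ lift (sym cw≡i)

  connected⇒≡ : ∀ {u w} → Connected H′ u w → c′ u ≡ c′ w
  connected⇒≡ ε = refl
  connected⇒≡ (a ◅ as) = trans
    ([ cong (identify i≢j)
     , (λ (u∈ , w∈) → trans (identify-≡ i≢j u∈) (sym (identify-≡ i≢j w∈))) ]′ (H′⇒c a))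
    (connected⇒≡ as)

Reducible : ∀ {r n} → ℕ → ℕ → RGraph r n → Set
Reducible {r} {n} K m H = ∃ λ (H′ : RGraph r n) → Admissible K m H′ × numEdges H′ ≤ numEdges H

-- Graphs with an isolated vertex

Isolated : ∀ {r n} → RGraph r n → Fin n → Set
Isolated H v = All.All (v ∉_) (edges H)

record ClosePair {r n} (H : RGraph r n) : Set where
  field
    {f g} : Subset n
    {x y} : Fin n
    f∈H : f ∈ˡ edges H
    g∈H : g ∈ˡ edges H
    f≢g : f ≢ g
    x≢y : x ≢ y
    x∈f : x ∈ f
    y∈f : y ∈ f
    x∈g : x ∈ g
    y∈g : y ∈ g

-- Here `K` stands for (r-1)k - 1, the upper entry of the binomial coefficient; the covering
-- condition is for sets of size K + 2.
module _ {s n K} (2≤s : 2 ≤ s) (H : RGraph (suc s) n) (v : Fin n) (isolated : Isolated H v)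
  (n-large : suc (suc K) + K C s ≤ n) where

  private
    Independent : Subset n → Set
    Independent I = All.All (λ e → ¬ e ⊆ I) (edges H)

    -- What w is sent to in the pigeonhole argument; singletons have fewer elements than s-sets.
    data Key (I : Subset n) (w : Fin n) (q : Subset n) : Set where
      excluded : w ∈ I ∪ ⁅ v ⁆ → q ≡ ⁅ w ⁆ → Key I w q
      blocked : ∀ {e} → e ∈ˡ edges H → w ∉ I → w ∈ e → e ⊆ I ∪ ⁅ w ⁆ → q ≡ e - w → Key I w q

    removed-size : ∀ {e w} → e ∈ˡ edges H → w ∈ e → ∣ e - w ∣ ≡ s
    removed-size e∈H w∈e =
      suc-injective (trans (∣p-x∣+1 w∈e) (All.lookup (uniform H) e∈H))

    removed⊆ : ∀ {I e : Subset n} {w} → e ⊆ I ∪ ⁅ w ⁆ → e - w ⊆ I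
    removed⊆ {I} {e} {w} e⊆ x∈ with x∈p∪q⁻ I ⁅ w ⁆ (e⊆ (p-x⊆p x∈))
    ... | inj₁ x∈I = x∈I
    ... | inj₂ x∈w with refl ← x∈⁅y⁆⇒x≡y w x∈w = contradiction x∈ (x∉p-x e)

    -- For `w` outside `I ∪ ⁅ v ⁆`, maximality gives an edge inside `I ∪ ⁅ w ⁆`. It contains `w`
    -- because `I` is independent, so its other `s` vertices lie in `I`.
    key : ∀ I → Independent I → (∀ w → w ∉ I ∪ ⁅ v ⁆ → Any.Any (_⊆ I ∪ ⁅ w ⁆) (edges H)) →
      ∀ w → ∃ (Key I w)
    key I ind maximal w with w ∈? I ∪ ⁅ v ⁆
    ... | yes w∈ = ⁅ w ⁆ , excluded w∈ refl
    ... | no w∉ with find (maximal w w∉)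
    ... | e , e∈H , e⊆ with w ∈? e
    ... | yes w∈e = e - w , blocked e∈H (w∉ ∘ p⊆p∪q ⁅ v ⁆) w∈e e⊆ refl
    ... | no w∉e = contradiction (λ {x} → e⊆I {x}) (All.lookup ind e∈H)
      where
      e⊆I : e ⊆ I
      e⊆I x∈e = removed⊆ e⊆ (x∈p∧x≢y⇒x∈p-y x∈e (∈-≢ x∈e w∉e))

    keys : Subset n → List (Subset n)
    keys I = choose (I ∪ ⁅ v ⁆) 1 ++ˡ choose I s

    key∈keys : ∀ {I w q} → Key I w q → q ∈ˡ keys I
    key∈keys {I} {w} (excluded w∈ refl) = ∈-++⁺ˡ (subst (λ j → ⁅ w ⁆ ∈ˡ choose (I ∪ ⁅ v ⁆) j)
      (∣⁅x⁆∣≡1 w)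
      (∈-choose (I ∪ ⁅ v ⁆) ⁅ w ⁆ λ x∈ → subst (_∈ I ∪ ⁅ v ⁆) (sym (x∈⁅y⁆⇒x≡y w x∈)) w∈))
    key∈keys {I} {w} (blocked {e} e∈H w∉I w∈e e⊆ refl) =
      ∈-++⁺ʳ (choose (I ∪ ⁅ v ⁆) 1) (subst (λ j → e - w ∈ˡ choose I j)
        (removed-size e∈H w∈e) (∈-choose I (e - w) (removed⊆ e⊆)))

    -- There are |I| + 1 singletons and C(|I|, s) sets of size `s`; for |I| ≤ K this stays below the
    -- lower bound on `n`.
    length-keys : ∀ {I} → v ∉ I → ∣ I ∣ ≤ K → length (keys I) < n
    length-keys {I} v∉I I≤K = ≤-trans (s≤s (begin
      length (keys I)                                   ≡⟨ length-++ (choose (I ∪ ⁅ v ⁆) 1) ⟩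
      length (choose (I ∪ ⁅ v ⁆) 1) + length (choose I s)
        ≡⟨ cong₂ _+_ (trans (length-choose (I ∪ ⁅ v ⁆) 1) (nC1≡n _)) (length-choose I s) ⟩
      ∣ I ∪ ⁅ v ⁆ ∣ + ∣ I ∣ C s                          ≡⟨ cong (_+ ∣ I ∣ C s) (∣p∪⁅x⁆∣ v∉I) ⟩
      suc ∣ I ∣ + ∣ I ∣ C s                              ≤⟨ +-mono-≤ (s≤s I≤K) (C-mono I≤K) ⟩
      suc K + K C s                                      ∎)) n-large
      where
      open ≤-Reasoning
      C-mono : ∀ {a b} → a ≤ b → a C s ≤ b C s
      C-mono {a} {b} a≤b = subst (λ d → a C s ≤ d C s) (m∸n+n≡m a≤b) (C-monoˡ-+ (b ∸ a) a s)

    singleton≢removed : ∀ {e u w} → e ∈ˡ edges H → w ∈ e → ⁅ u ⁆ ≢ e - w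
    singleton≢removed {u = u} e∈H w∈e eq =
      <-irrefl (trans (sym (∣⁅x⁆∣≡1 u)) (trans (cong ∣_∣ eq) (removed-size e∈H w∈e))) 2≤s

    -- Singletons determine their vertex and are smaller than `s`-sets, so both keys come from
    -- edges. These share `s` ≥ 2 vertices, and they differ because the second one misses `u`.
    collision : ∀ {I u w q} → u ≢ w → Key I u q → Key I w q → ClosePair H
    collision u≢w (excluded _ refl) (excluded _ eq) =
      contradiction (x∈⁅y⁆⇒x≡y _ (subst (_ ∈_) eq (x∈⁅x⁆ _))) u≢w
    collision u≢w (excluded _ refl) (blocked e∈H _ w∈e _ eq) =
      contradiction eq (singleton≢removed e∈H w∈e)
    collision u≢w (blocked e∈H _ u∈e _ refl) (excluded _ eq) =
      contradiction (sym eq) (singleton≢removed e∈H u∈e)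
    collision {I} {u} {w} u≢w (blocked {e} e∈H u∉I u∈e _ refl) (blocked {e′} e′∈H _ _ e′⊆ eq)
      with two-more (subst (3 ≤_) (sym (All.lookup (uniform H) e∈H)) (s≤s 2≤s)) u∈e
    ... | x , y , x∈e , y∈e , x≢u , y≢u , x≢y = record
      { f∈H = e∈H ; g∈H = e′∈H ; f≢g = λ { refl → u∉I∪w (e′⊆ u∈e) } ; x≢y = x≢y
      ; x∈f = x∈e ; y∈f = y∈e ; x∈g = shared x∈e x≢u ; y∈g = shared y∈e y≢u }
      where
      u∉I∪w : u ∉ I ∪ ⁅ w ⁆
      u∉I∪w = [ u∉I , u≢w ∘ x∈⁅y⁆⇒x≡y w ]′ ∘ x∈p∪q⁻ I ⁅ w ⁆
      shared : ∀ {z} → z ∈ e → z ≢ u → z ∈ e′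
      shared z∈e z≢u = p-x⊆p (subst (_ ∈_) eq (x∈p∧x≢y⇒x∈p-y z∈e z≢u))

    -- Greedy growth of an independent set avoiding `v`. If it gets stuck at a size of at most `K`,
    -- the set is maximal and the pigeonhole principle gives a close pair.
    extend : ∀ t → t ≤ suc K → ClosePair H ⊎ ∃ λ I → ∣ I ∣ ≡ t × v ∉ I × Independent I
    extend zero _ = inj₂ (⊥ , ∣⊥∣≡0 n , ∉⊥ , All.tabulate no-empty)
      where
      no-empty : ∀ {e} → e ∈ˡ edges H → ¬ e ⊆ ⊥
      no-empty {e} e∈H e⊆⊥ with ∣p∣>0⇒nonempty e
        (subst (1 ≤_) (sym (All.lookup (uniform H) e∈H)) (s≤s z≤n))
      ... | _ , x∈e = ∉⊥ (e⊆⊥ x∈e)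
    extend (suc t) t<K with extend t (≤-trans (n≤1+n t) t<K)
    ... | inj₁ close = inj₁ close
    ... | inj₂ (I , ∣I∣≡t , v∉I , ind)
      with any? (λ w → ¬? (w ∈? I ∪ ⁅ v ⁆) ×-dec All.all? (λ e → ¬? (e ⊆? I ∪ ⁅ w ⁆)) (edges H))
    ... | yes (w , w∉ , ind′) = inj₂ (I ∪ ⁅ w ⁆ , trans (∣p∪⁅x⁆∣ (w∉ ∘ p⊆p∪q ⁅ v ⁆)) (cong suc ∣I∣≡t)
      , [ v∉I , (λ v∈w → w∉ (q⊆p∪q I ⁅ v ⁆ (subst (λ z → w ∈ ⁅ z ⁆) (sym (x∈⁅y⁆⇒x≡y w v∈w)) (x∈⁅x⁆ w)))) ]′
          ∘ x∈p∪q⁻ I ⁅ w ⁆ , ind′)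
    ... | no ¬extendable = inj₁ collide
      where
      maximal : ∀ w → w ∉ I ∪ ⁅ v ⁆ → Any.Any (_⊆ I ∪ ⁅ w ⁆) (edges H)
      maximal w w∉ with Any.any? (_⊆? I ∪ ⁅ w ⁆) (edges H)
      ... | yes found = found
      ... | no none = contradiction (w , w∉ , All.¬Any⇒All¬ (edges H) none) ¬extendable
      collide : ClosePair H
      collide with pigeonhole-∈ (keys I) (proj₁ ∘ key I ind maximal)
        (key∈keys ∘ proj₂ ∘ key I ind maximal)
        (length-keys v∉I (subst (_≤ K) (sym ∣I∣≡t) (s≤s⁻¹ t<K)))
      ... | u , w , u≢w , eq = collision u≢w (subst (Key I u) eq (proj₂ (key I ind maximal u)))
        (proj₂ (key I ind maximal w))

  -- An independent set of size K + 1 avoiding `v` cannot exist: together with `v` it would contain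
  -- an edge, and no edge uses the isolated vertex `v`.
  close-pair : Covering H (suc (suc K)) → ClosePair H
  close-pair cov with extend (suc K) ≤-refl
  ... | inj₁ close = close
  ... | inj₂ (I , ∣I∣≡1+K , v∉I , ind)
    with cov (I ∪ ⁅ v ⁆) (trans (∣p∪⁅x⁆∣ v∉I) (cong suc ∣I∣≡1+K))
  ... | e , e∈H , e⊆ = contradiction (λ {x} → e⊆I {x}) (All.lookup ind e∈H)
    where
    e⊆I : e ⊆ I
    e⊆I x∈e = removed⊆ e⊆ (x∈p∧x≢y⇒x∈p-y x∈e (∈-≢ x∈e (All.lookup isolated e∈H)))

-- Moving f from x to the isolated vertex v keeps the covering condition: a set S containing f but not
-- v can be replaced by S - x + v, and the edge found there avoids both x and v.
module _ {r n K m} (H : RGraph r n) (comps : HasComponents H (suc m)) (cov : Covering H K)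
  (v : Fin n) (isolated : Isolated H v) (close : ClosePair H) where

  open ClosePair close

  private
    c = proj₁ comps

    mono : Monochromatic H c
    mono = components-monochromatic H comps

    v∉ : ∀ {e} → e ∈ˡ edges H → v ∉ e
    v∉ = All.lookup isolated

    f′ : Subset n
    f′ = exchange x v f

    ≢f? : (e : Subset n) → Dec (e ≢ f)
    ≢f? e = ¬? (≡-dec _≟ᵇ_ e f)

    kept = filter ≢f? (edges H)

    v∈f′ : v ∈ f′
    v∈f′ = ∈-exchange-new x∈f

    H′ : RGraph r n
    H′ = record
      { edges = f′ ∷ kept
      ; uniform = trans (∣exchange∣ x v f) (All.lookup (uniform H) f∈H)
          All.∷ All.filter⁺ ≢f? (uniform H)
      -- The new edge contains `v` and therefore differs from every old one.
      ; distinct = All.tabulate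
            (λ e∈ eq → v∉ (proj₁ (∈-filter⁻ ≢f? e∈)) (subst (v ∈_) eq v∈f′))
          AllPairs.∷ Unique.filter⁺ ≢f? (distinct H)
      }

    keep : ∀ {e} → e ∈ˡ edges H → e ≢ f → e ∈ˡ edges H′
    keep e∈H e≢f = there (∈-filter⁺ ≢f? e∈H e≢f)

    H′-covering : Covering H′ K
    H′-covering S ∣S∣≡K with cov S ∣S∣≡K
    ... | e , e∈H , e⊆S with ≡-dec _≟ᵇ_ e f
    ... | no e≢f = e , keep e∈H e≢f , e⊆S
    ... | yes refl with v ∈? S
    ... | yes v∈S = f′ , here refl ,
      [ (λ { refl → v∈S }) , e⊆S ∘ proj₁ ]′ ∘ ∈-exchange⁻ (v∉ f∈H)
    ... | no v∉S with cov (exchange x v S) (trans (∣exchange∣ x v S) ∣S∣≡K)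
    ... | e′ , e′∈H , e′⊆ = e′ , keep e′∈H (λ { refl → x∉e′ x∈f }) , proj₁ ∘ avoid
      where
      avoid : ∀ {z} → z ∈ e′ → z ∈ S × z ≢ x
      avoid z∈e′ = [ (λ { refl → contradiction z∈e′ (v∉ e′∈H) }) , id ]′ (∈-exchange⁻ v∉S (e′⊆ z∈e′))
      x∉e′ : x ∉ e′
      x∉e′ x∈e′ = proj₂ (avoid x∈e′) refl

    y∈f′ : y ∈ f′
    y∈f′ = ∈-exchange-old y∈f (x≢y ∘ sym) (v∉ f∈H)

    -- Only `x` has left the edge, and `g` still links it to `y`.
    f-connected-y : ∀ {u} → u ∈ f → Connected H′ u y
    f-connected-y {u} u∈f with u ≟ x
    ... | yes refl = adj⇒connected H′ (keep g∈H (f≢g ∘ sym)) x∈g y∈g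
    ... | no u≢x = adj⇒connected H′ (here refl) (∈-exchange-old u∈f u≢x (v∉ f∈H)) y∈f′

    H⇒H′ : ∀ {u w} → Adj H u w → Connected H′ u w
    H⇒H′ (e , e∈H , u∈e , w∈e) with ≡-dec _≟ᵇ_ e f
    ... | no e≢f = adj⇒connected H′ (keep e∈H e≢f) u∈e w∈e
    ... | yes refl = f-connected-y u∈e ◅◅ connected-sym H′ (f-connected-y w∈e)

    f′-colour : ∀ {u} → u ∈ f′ → c u ≡ c v ⊎ c u ≡ c y
    f′-colour u∈f′ = [ (λ { refl → inj₁ refl }) , (λ (u∈f , _) → inj₂ (mono f∈H u∈f y∈f)) ]′
      (∈-exchange⁻ (v∉ f∈H) u∈f′)

    -- A path starting at an isolated vertex is trivial, and `v` differs from `y` because `y ∈ f`.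
    cv≢cy : c v ≢ c y
    cv≢cy eq with proj₁ (proj₂ (proj₂ comps) v y) eq
    ... | ε = v∉ f∈H y∈f
    ... | (_ , e∈H , v∈e , _) ◅ _ = v∉ e∈H v∈e

    H′-components : HasComponents H′ m
    H′-components = merge-components H H′ comps v y cv≢cy (adj⇒connected H′ (here refl) v∈f′ y∈f′) H⇒H′ λ where
      (_ , here refl , u∈f′ , w∈f′) → inj₂ (f′-colour u∈f′ , f′-colour w∈f′)
      (_ , there e∈ , u∈e , w∈e) → inj₁ (mono (proj₁ (∈-filter⁻ ≢f? e∈)) u∈e w∈e)

  isolated-reducible : Reducible K m H
  isolated-reducible = H′ , (H′-components , H′-covering) ,
    -- Deleting `f` makes the list strictly shorter, which pays for `f′`.
    filter-notAll ≢f? (edges H) (lose f∈H (λ f≢f → f≢f refl))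

-- Graphs without isolated vertices

⋃-map⁻ : ∀ {n k} (T : Fin k → Subset n) js {x} → x ∈ ⋃ (map T js) → ∃ λ j → j ∈ˡ js × x ∈ T j
⋃-map⁻ T [] x∈ = contradiction x∈ ∉⊥
⋃-map⁻ T (j ∷ js) x∈ with x∈p∪q⁻ (T j) _ x∈
... | inj₁ x∈Tj = j , here refl , x∈Tj
... | inj₂ x∈⋃ with ⋃-map⁻ T js x∈⋃
... | i , i∈js , x∈Ti = i , there i∈js , x∈Ti

⋃-map⁺ : ∀ {n k} (T : Fin k → Subset n) {js x j} → j ∈ˡ js → x ∈ T j → x ∈ ⋃ (map T js)
⋃-map⁺ T (here refl) x∈ = p⊆p∪q _ x∈
⋃-map⁺ T (there j∈) x∈ = q⊆p∪q (T _) _ (⋃-map⁺ T j∈ x∈)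

module _ {n k d} (c : Fin n → Fin k) (T : Fin k → Subset n) (∣T∣ : ∀ j → ∣ T j ∣ ≡ d)
  (T-colour : ∀ j {x} → x ∈ T j → c x ≡ j) where

  ∣⋃∣ : ∀ js → Unique js → ∣ ⋃ (map T js) ∣ ≡ length js * d
  ∣⋃∣ [] _ = ∣⊥∣≡0 n
  ∣⋃∣ (j ∷ js) (j∉js AllPairs.∷ distinct-js) =
    trans (∣p∪q∣-disjoint disj) (cong₂ _+_ (∣T∣ j) (∣⋃∣ js distinct-js))
    where
    disj : ∀ {x} → x ∈ T j → x ∉ ⋃ (map T js)
    disj x∈Tj x∈⋃ with ⋃-map⁻ T js x∈⋃
    ... | i , i∈js , x∈Ti = All.lookup j∉js i∈js (trans (sym (T-colour j x∈Tj)) (T-colour i x∈Ti))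

  transversal : Subset n
  transversal = ⋃ (map T (allFin k))

  ∣transversal∣ : ∣ transversal ∣ ≡ k * d
  ∣transversal∣ = trans (∣⋃∣ (allFin k) (Unique.allFin⁺ k)) (cong (_* d) (length-tabulate {n = k} id))

  -- The colour of a vertex determines the only `T j` that can contain it.
  ∈-transversal⁻ : ∀ {x} → x ∈ transversal → x ∈ T (c x)
  ∈-transversal⁻ x∈ with ⋃-map⁻ T (allFin k) x∈
  ... | j , _ , x∈Tj = subst (λ i → _ ∈ T i) (sym (T-colour j x∈Tj)) x∈Tj

  ∈-transversal⁺ : ∀ {x} → x ∈ T (c x) → x ∈ transversal
  ∈-transversal⁺ = ⋃-map⁺ T (∈-allFin _)

-- Switching the sets that separate a pair of vertices

switch : ∀ {n} → (Fin n → Fin n) → (Subset n → Bool) → Subset n → Subset n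
switch t split p = if split p then preimage t p else p

module _ {n} (t : Fin n → Fin n) (split : Subset n → Bool) {p : Subset n} where

  switch-true : split p ≡ true → switch t split p ≡ preimage t p
  switch-true = cong (λ s → if s then preimage t p else p)

  switch-false : split p ≡ false → switch t split p ≡ p
  switch-false = cong (λ s → if s then preimage t p else p)

-- The vertices a, a′ of one colour and b, b′ of another are interchanged by t; split holds for the
-- sets containing exactly one of a, a′ or exactly one of b, b′. Keeping t and split as parameters
-- makes switch t split literally invariant under the symmetries twin and flip.
record Quad {n k} (c : Fin n → Fin k) (t : Fin n → Fin n) (split : Subset n → Bool) : Set where
  field
    a a′ b b′ : Fin n
    a≢a′ : a ≢ a′
    b≢b′ : b ≢ b′
    ca≡ca′ : c a ≡ c a′
    cb≡cb′ : c b ≡ c b′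
    ca≢cb : c a ≢ c b
    ta : t a ≡ b
    ta′ : t a′ ≡ b′
    tb : t b ≡ a
    tb′ : t b′ ≡ a′
    t-fixed : ∀ {x} → x ≢ a → x ≢ a′ → x ≢ b → x ≢ b′ → t x ≡ x
    split-≡ : ∀ p → split p ≡ (lookup p a xor lookup p a′) ∨ (lookup p b xor lookup p b′)

module _ {n k} {c : Fin n → Fin k} {t : Fin n → Fin n} {split : Subset n → Bool} where

  flip : Quad c t split → Quad c t split
  flip Q = record
    { a = b ; a′ = b′ ; b = a ; b′ = a′ ; a≢a′ = b≢b′ ; b≢b′ = a≢a′ ; ca≡ca′ = cb≡cb′ ; cb≡cb′ = ca≡ca′
    ; ca≢cb = ca≢cb ∘ sym ; ta = tb ; ta′ = tb′ ; tb = ta ; tb′ = ta′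
    ; t-fixed = λ x≢b x≢b′ x≢a x≢a′ → t-fixed x≢a x≢a′ x≢b x≢b′
    ; split-≡ = λ p → trans (split-≡ p) (∨-comm (lookup p a xor lookup p a′) _)
    }
    where open Quad Q

  twin : Quad c t split → Quad c t split
  twin Q = record
    { a = a′ ; a′ = a ; b = b′ ; b′ = b ; a≢a′ = a≢a′ ∘ sym ; b≢b′ = b≢b′ ∘ sym
    ; ca≡ca′ = sym ca≡ca′ ; cb≡cb′ = sym cb≡cb′
    ; ca≢cb = λ eq → ca≢cb (trans ca≡ca′ (trans eq (sym cb≡cb′)))
    ; ta = ta′ ; ta′ = ta ; tb = tb′ ; tb′ = tb
    ; t-fixed = λ x≢a′ x≢a x≢b′ x≢b → t-fixed x≢a x≢a′ x≢b x≢b′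
    ; split-≡ = λ p → trans (split-≡ p)
        (cong₂ _∨_ (xor-comm (lookup p a) _) (xor-comm (lookup p b) _))
    }
    where open Quad Q

  data Role (Q : Quad c t split) (x : Fin n) : Set where
    is-a : x ≡ Quad.a Q → Role Q x
    is-a′ : x ≡ Quad.a′ Q → Role Q x
    is-b : x ≡ Quad.b Q → Role Q x
    is-b′ : x ≡ Quad.b′ Q → Role Q x
    is-fixed : x ≢ Quad.a Q → x ≢ Quad.a′ Q → x ≢ Quad.b Q → x ≢ Quad.b′ Q → Role Q x

  role : ∀ Q x → Role Q x
  role Q x with x ≟ Quad.a Q | x ≟ Quad.a′ Q | x ≟ Quad.b Q | x ≟ Quad.b′ Q
  ... | yes eq | _ | _ | _ = is-a eq
  ... | no _ | yes eq | _ | _ = is-a′ eq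
  ... | no _ | no _ | yes eq | _ = is-b eq
  ... | no _ | no _ | no _ | yes eq = is-b′ eq
  ... | no x≢a | no x≢a′ | no x≢b | no x≢b′ = is-fixed x≢a x≢a′ x≢b x≢b′

  ∉⇒lookup : ∀ {x : Fin n} {p} → x ∉ p → lookup p x ≡ false
  ∉⇒lookup {x} {p} x∉p with lookup p x in eq
  ... | true = contradiction (lookup⇒[]= x p eq) x∉p
  ... | false = refl

  split-false⁺ : ∀ (Q : Quad c t split) {p} → let open Quad Q in
    a ∈ p → a′ ∈ p → b ∉ p → b′ ∉ p → split p ≡ false
  split-false⁺ Q {p} a∈ a′∈ b∉ b′∉ = trans (Quad.split-≡ Q p) (cong₂ _∨_
    (cong₂ _xor_ ([]=⇒lookup a∈) ([]=⇒lookup a′∈)) (cong₂ _xor_ (∉⇒lookup b∉) (∉⇒lookup b′∉)))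

  split-true⁺ : ∀ (Q : Quad c t split) {p} → let open Quad Q in a ∈ p → a′ ∉ p → split p ≡ true
  split-true⁺ Q {p} a∈ a′∉ = trans (Quad.split-≡ Q p)
    (cong (_∨ (lookup p (Quad.b Q) xor lookup p (Quad.b′ Q))) (cong₂ _xor_ ([]=⇒lookup a∈) (∉⇒lookup a′∉)))

  Involved : Quad c t split → Fin n → Set
  Involved Q x = c x ≡ c (Quad.a Q) ⊎ c x ≡ c (Quad.b Q)

  -- One of the four symmetric forms of the quad has its first vertex in `p` and its second outside.
  -- Later arguments about split sets thus treat only `a ∈ p`, `a′ ∉ p`, with `t` and `split`
  -- unchanged.
  split-true⁻ : ∀ Q {p} → split p ≡ true →
    Σ (Quad c t split) λ Q′ → Quad.a Q′ ∈ p × Quad.a′ Q′ ∉ p ×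
      Involved Q (Quad.a Q′) × Involved Q (Quad.b Q′)
  split-true⁻ Q {p} eq with Quad.a Q ∈? p | Quad.a′ Q ∈? p | Quad.b Q ∈? p | Quad.b′ Q ∈? p
  ... | yes a∈ | no a′∉ | _ | _ = Q , a∈ , a′∉ , inj₁ refl , inj₂ refl
  ... | no a∉ | yes a′∈ | _ | _ =
    twin Q , a′∈ , a∉ , inj₁ (sym (Quad.ca≡ca′ Q)) , inj₂ (sym (Quad.cb≡cb′ Q))
  ... | _ | _ | yes b∈ | no b′∉ = flip Q , b∈ , b′∉ , inj₂ refl , inj₁ refl
  ... | _ | _ | no b∉ | yes b′∈ =
    flip (twin Q) , b′∈ , b∉ , inj₂ (sym (Quad.cb≡cb′ Q)) , inj₁ (sym (Quad.ca≡ca′ Q))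
  ... | yes a∈ | yes a′∈ | no b∉ | no b′∉ =
    contradiction (trans (sym eq) (split-false⁺ Q a∈ a′∈ b∉ b′∉)) λ ()
  ... | no a∉ | no a′∉ | yes b∈ | yes b′∈ =
    contradiction (trans (sym eq) (split-false⁺ (flip Q) b∈ b′∈ a∉ a′∉)) λ ()
  ... | yes a∈ | yes a′∈ | yes b∈ | yes b′∈ =
    contradiction (trans (sym eq) (trans (Quad.split-≡ Q p) (cong₂ _∨_
      (cong₂ _xor_ ([]=⇒lookup a∈) ([]=⇒lookup a′∈))
      (cong₂ _xor_ ([]=⇒lookup b∈) ([]=⇒lookup b′∈))))) λ ()
  ... | no a∉ | no a′∉ | no b∉ | no b′∉ =
    contradiction (trans (sym eq) (trans (Quad.split-≡ Q p) (cong₂ _∨_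
      (cong₂ _xor_ (∉⇒lookup a∉) (∉⇒lookup a′∉))
      (cong₂ _xor_ (∉⇒lookup b∉) (∉⇒lookup b′∉))))) λ ()

  t-involutive : Quad c t split → ∀ x → t (t x) ≡ x
  t-involutive Q x with role Q x
  ... | is-a refl = trans (cong t (Quad.ta Q)) (Quad.tb Q)
  ... | is-a′ refl = trans (cong t (Quad.ta′ Q)) (Quad.tb′ Q)
  ... | is-b refl = trans (cong t (Quad.tb Q)) (Quad.ta Q)
  ... | is-b′ refl = trans (cong t (Quad.tb′ Q)) (Quad.ta′ Q)
  ... | is-fixed x≢a x≢a′ x≢b x≢b′ = trans (cong t tx≡x) tx≡x
    where tx≡x = Quad.t-fixed Q x≢a x≢a′ x≢b x≢b′

  preimage-involutive : Quad c t split → ∀ p → preimage t (preimage t p) ≡ p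
  preimage-involutive Q p = ⊆-antisym
    (λ {x} x∈ → subst (_∈ p) (t-involutive Q x) (∈-preimage⁻ t (∈-preimage⁻ t x∈)))
    (λ {x} x∈ → ∈-preimage⁺ t (∈-preimage⁺ t (subst (_∈ p) (sym (t-involutive Q x)) x∈)))

  -- Since `t` interchanges the two pairs, the two disjuncts of `split` merely trade places. A
  -- second switch therefore makes the same decision as the first and undoes it.
  split-preimage : Quad c t split → ∀ p → split (preimage t p) ≡ split p
  split-preimage Q p = trans (split-≡ (preimage t p))
    (trans (cong₂ _∨_ (cong₂ _xor_ (at ta) (at ta′)) (cong₂ _xor_ (at tb) (at tb′)))
    (trans (∨-comm (lookup p b xor lookup p b′) _) (sym (split-≡ p))))
    where
    open Quad Q
    at : ∀ {x y} → t x ≡ y → lookup (preimage t p) x ≡ lookup p y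
    at {x} tx≡y = trans (lookup∘tabulate (lookup p ∘ t) x) (cong (lookup p) tx≡y)

  switch-involutive : Quad c t split → ∀ p → switch t split (switch t split p) ≡ p
  switch-involutive Q p with split p in eq
  ... | true = trans (switch-true t split (trans (split-preimage Q p) eq)) (preimage-involutive Q p)
  ... | false = switch-false t split eq

  ∣preimage-t∣ : Quad c t split → ∀ p → ∣ preimage t p ∣ ≡ ∣ p ∣
  ∣preimage-t∣ Q = ∣preimage∣ t t (t-involutive Q) (t-involutive Q)

  ∣switch∣ : Quad c t split → ∀ p → ∣ switch t split p ∣ ≡ ∣ p ∣
  ∣switch∣ Q p with split p
  ... | true = ∣preimage-t∣ Q p
  ... | false = refl

-- The colours keep the `a` vertices apart from the `b` vertices, so the two transpositions are
-- disjoint.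
quad : ∀ {n k} (c : Fin n → Fin k) {a a′ b b′} → a ≢ a′ → b ≢ b′ → c a ≡ c a′ → c b ≡ c b′ → c a ≢ c b →
  Quad c (transpose a b ∘ transpose a′ b′)
    (λ p → (lookup p a xor lookup p a′) ∨ (lookup p b xor lookup p b′))
quad c {a} {a′} {b} {b′} a≢a′ b≢b′ ca≡ca′ cb≡cb′ ca≢cb = record
  { a = a ; a′ = a′ ; b = b ; b′ = b′ ; a≢a′ = a≢a′ ; b≢b′ = b≢b′
  ; ca≡ca′ = ca≡ca′ ; cb≡cb′ = cb≡cb′ ; ca≢cb = ca≢cb
  ; ta = trans (cong (transpose a b) (transpose-≢ a≢a′ a≢b′)) (transpose-ˡ a b)
  ; ta′ = trans (cong (transpose a b) (transpose-ˡ a′ b′)) (transpose-≢ (a≢b′ ∘ sym) (b≢b′ ∘ sym))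
  ; tb = trans (cong (transpose a b) (transpose-≢ b≢a′ b≢b′)) (transpose-ʳ a b)
  ; tb′ = trans (cong (transpose a b) (transpose-ʳ a′ b′)) (transpose-≢ (a≢a′ ∘ sym) (b≢a′ ∘ sym))
  ; t-fixed = λ x≢a x≢a′ x≢b x≢b′ →
      trans (cong (transpose a b) (transpose-≢ x≢a′ x≢b′)) (transpose-≢ x≢a x≢b)
  ; split-≡ = λ _ → refl
  }
  where
  a≢b′ : a ≢ b′
  a≢b′ eq = ca≢cb (trans (cong c eq) (sym cb≡cb′))
  b≢a′ : b ≢ a′
  b≢a′ eq = ca≢cb (trans ca≡ca′ (sym (cong c eq)))

-- A local form of completeness: when `c` colours the components, such exchanges lead from one edge
-- to every `r`-subset of its component.
ExchangeClosed : ∀ {r n k} → RGraph r n → (Fin n → Fin k) → Set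
ExchangeClosed H c = ∀ {e u w} → e ∈ˡ edges H → u ∈ e → w ∉ e → c w ≡ c u → exchange u w e ∈ˡ edges H

-- Switching in a graph with complete components

module _ {r n m K} (3≤r : 3 ≤ r) (H : RGraph r n) (comps : HasComponents H (suc m))
  (cov : Covering H K) (exchange-∈ : ExchangeClosed H (proj₁ comps))
  {t : Fin n → Fin n} {split : Subset n → Bool} (Q₀ : Quad (proj₁ comps) t split) where

  private
    c : Fin n → Fin (suc m)
    c = proj₁ comps

    mono : Monochromatic H c
    mono = components-monochromatic H comps

    σ : Subset n → Subset n
    σ = switch t split

    σ-injective : ∀ {p q} → σ p ≡ σ q → p ≡ q
    σ-injective {p} {q} eq =
      trans (sym (switch-involutive Q₀ p)) (trans (cong σ eq) (switch-involutive Q₀ q))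

    H′ : RGraph r n
    H′ = record
      { edges = map σ (edges H)
      ; uniform = All.map⁺ (All.map (λ {e} ∣e∣≡r → trans (∣switch∣ Q₀ e) ∣e∣≡r) (uniform H))
      ; distinct = Unique.map⁺ σ-injective (distinct H)
      }

    σ-∈ : ∀ {e e′} → e ∈ˡ edges H → σ e ≡ e′ → e′ ∈ˡ edges H′
    σ-∈ e∈H refl = ∈-map⁺ σ e∈H

    module _ (Q : Quad c t split) where
      open Quad Q

      a-edge-avoids : ∀ {e x} → e ∈ˡ edges H → x ∈ e → c x ≡ c a → b ∉ e × b′ ∉ e
      a-edge-avoids e∈H x∈e cx≡ca =
        (λ b∈e → ca≢cb (trans (sym cx≡ca) (mono e∈H x∈e b∈e))) ,
        (λ b′∈e → ca≢cb (trans (sym cx≡ca) (trans (mono e∈H x∈e b′∈e) (sym cb≡cb′))))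

      -- The exchanged edge contains both `a` and `a′` and neither `b` nor `b′`, so the switch
      -- leaves it in place.
      unsplit : ∀ {e z} → e ∈ˡ edges H → a ∈ e → a′ ∉ e → z ∈ e → z ≢ a →
        exchange z a′ e ∈ˡ edges H′
      unsplit {e} {z} e∈H a∈e a′∉e z∈e z≢a =
        σ-∈ e₁∈H (switch-false t split (split-false⁺ Q a∈e₁ (∈-exchange-new z∈e) (proj₁ b∉) (proj₂ b∉)))
        where
        e₁∈H : exchange z a′ e ∈ˡ edges H
        e₁∈H = exchange-∈ e∈H z∈e a′∉e (trans (sym ca≡ca′) (mono e∈H a∈e z∈e))
        a∈e₁ : a ∈ exchange z a′ e
        a∈e₁ = ∈-exchange-old a∈e (z≢a ∘ sym) a′∉e
        b∉ : b ∉ exchange z a′ e × b′ ∉ exchange z a′ e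
        b∉ = a-edge-avoids e₁∈H a∈e₁ refl

      switched-edge : ∀ {e} → e ∈ˡ edges H → a ∈ e → a′ ∉ e → preimage t e ∈ˡ edges H′
      switched-edge e∈H a∈e a′∉e = σ-∈ e∈H (switch-true t split (split-true⁺ Q a∈e a′∉e))

      -- Of the four special vertices `e` contains only `a`, so its switched form is e - a + b.
      ∈-switched⁻ : ∀ {e} → e ∈ˡ edges H → a ∈ e → a′ ∉ e → ∀ {x} →
        x ∈ preimage t e → x ≡ b ⊎ (x ∈ e × x ≢ a)
      ∈-switched⁻ {e} e∈H a∈e a′∉e {x} x∈ with role Q x
      ... | is-a refl = contradiction (subst (_∈ e) ta (∈-preimage⁻ t x∈)) (proj₁ (a-edge-avoids e∈H a∈e refl))
      ... | is-a′ refl = contradiction (subst (_∈ e) ta′ (∈-preimage⁻ t x∈)) (proj₂ (a-edge-avoids e∈H a∈e refl))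
      ... | is-b x≡b = inj₁ x≡b
      ... | is-b′ refl = contradiction (subst (_∈ e) tb′ (∈-preimage⁻ t x∈)) a′∉e
      ... | is-fixed x≢a x≢a′ x≢b x≢b′ =
        inj₂ (subst (_∈ e) (t-fixed x≢a x≢a′ x≢b x≢b′) (∈-preimage⁻ t x∈) , x≢a)

      ∈-switched⁺ : ∀ {e} → e ∈ˡ edges H → a ∈ e → a′ ∉ e → ∀ {x} → x ∈ e → x ≢ a → x ∈ preimage t e
      ∈-switched⁺ {e} e∈H a∈e a′∉e x∈e x≢a = ∈-preimage⁺ t (subst (_∈ e) (sym (t-fixed x≢a
        (∈-≢ x∈e a′∉e) (∈-≢ x∈e (proj₁ b∉)) (∈-≢ x∈e (proj₂ b∉)))) x∈e)
        where b∉ = a-edge-avoids e∈H a∈e refl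

      -- The switched edge still holds all of `e` except `a`. As r ≥ 3 there are two further
      -- vertices `y` and `z`, and the unsplit edge e - z + a′ links `a` to `y`.
      split-connected : ∀ {e} → e ∈ˡ edges H → a ∈ e → a′ ∉ e → ∀ {u w} → u ∈ e → w ∈ e → Connected H′ u w
      split-connected {e} e∈H a∈e a′∉e u∈e w∈e
        with two-more (subst (3 ≤_) (sym (All.lookup (uniform H) e∈H)) 3≤r) a∈e
      ... | y , z , y∈e , z∈e , y≢a , z≢a , y≢z = to-y u∈e ◅◅ connected-sym H′ (to-y w∈e)
        where
        to-y : ∀ {u} → u ∈ e → Connected H′ u y
        to-y {u} u∈e with u ≟ a
        ... | yes refl = adj⇒connected H′ (unsplit e∈H a∈e a′∉e z∈e z≢a)
          (∈-exchange-old a∈e (z≢a ∘ sym) a′∉e) (∈-exchange-old y∈e y≢z a′∉e)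
        ... | no u≢a = adj⇒connected H′ (switched-edge e∈H a∈e a′∉e)
          (∈-switched⁺ e∈H a∈e a′∉e u∈e u≢a) (∈-switched⁺ e∈H a∈e a′∉e y∈e y≢a)

    module _ (Q : Quad c t split) where
      open Quad Q

      -- The edge `e` itself may be lost, so a substitute inside `S` is sought. If `a′ ∈ S`, the
      -- unsplit edge e - z + a′ serves; if `b ∈ S`, the switched edge e - a + b does.
      split-covers : ∀ {e} {S : Subset n} → ∣ S ∣ ≡ K → e ∈ˡ edges H → e ⊆ S → a ∈ e → a′ ∉ e →
        ∃ λ e′ → e′ ∈ˡ edges H′ × e′ ⊆ S
      split-covers {e} {S} ∣S∣≡K e∈H e⊆S a∈e a′∉e with a′ ∈? S | b ∈? S | b′ ∈? S
      ... | yes a′∈S | _ | _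
        with two-more (subst (3 ≤_) (sym (All.lookup (uniform H) e∈H)) 3≤r) a∈e
      ... | _ , z , _ , z∈e , _ , z≢a , _ = _ , unsplit Q e∈H a∈e a′∉e z∈e z≢a ,
        [ (λ { refl → a′∈S }) , e⊆S ∘ proj₁ ]′ ∘ ∈-exchange⁻ a′∉e
      split-covers {e} {S} ∣S∣≡K e∈H e⊆S a∈e a′∉e | no _ | yes b∈S | _ =
        _ , switched-edge Q e∈H a∈e a′∉e , [ (λ { refl → b∈S }) , e⊆S ∘ proj₁ ]′ ∘ ∈-switched⁻ Q e∈H a∈e a′∉e
      -- Now `preimage t S` is S - a + b. An edge of `H` inside it either contains `b`, is split and
      -- switches back into `S`, or avoids `b` and already lies in `S`.
      split-covers {e} {S} ∣S∣≡K e∈H e⊆S a∈e a′∉e | no a′∉S | no b∉S | no b′∉S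
        with cov (preimage t S) (trans (∣preimage-t∣ Q S) ∣S∣≡K)
      ... | e₁ , e₁∈H , e₁⊆ = σ e₁ , σ-∈ e₁∈H refl , σe₁⊆S
        where
        avoid : ∀ {x y} → t x ≡ y → y ∉ S → x ∉ e₁
        avoid tx≡y y∉S x∈e₁ = y∉S (subst (_∈ S) tx≡y (∈-preimage⁻ t (e₁⊆ x∈e₁)))
        σe₁⊆S : σ e₁ ⊆ S
        σe₁⊆S {x} x∈ with split e₁ in eq
        ... | true = subst (_∈ S) (t-involutive Q x) (∈-preimage⁻ t (e₁⊆ (∈-preimage⁻ t x∈)))
        ... | false = subst (_∈ S) (t-fixed (∈-≢ x∈ (avoid ta b∉S)) (∈-≢ x∈ (avoid ta′ b′∉S))
          (∈-≢ x∈ b∉e₁) (∈-≢ x∈ (avoid tb′ a′∉S))) (∈-preimage⁻ t (e₁⊆ x∈))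
          where
          b∉e₁ : b ∉ e₁
          b∉e₁ b∈e₁ = case trans (sym eq) (split-true⁺ (flip Q) b∈e₁ (avoid tb′ a′∉S)) of λ ()
      -- By completeness e - a + a′ is an edge of `H`; switching it turns `a′` into `b′`.
      split-covers {e} {S} ∣S∣≡K e∈H e⊆S a∈e a′∉e | no a′∉S | no _ | yes b′∈S =
        _ , switched-edge (twin Q) e₁∈H (∈-exchange-new a∈e) a∉e₁ ,
        [ (λ { refl → b′∈S }) , (λ (x∈e₁ , x≢a′) →
            [ (λ x≡a′ → contradiction x≡a′ x≢a′) , e⊆S ∘ proj₁ ]′ (∈-exchange⁻ a′∉e x∈e₁)) ]′
          ∘ ∈-switched⁻ (twin Q) e₁∈H (∈-exchange-new a∈e) a∉e₁
        where
        e₁∈H : exchange a a′ e ∈ˡ edges H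
        e₁∈H = exchange-∈ e∈H a∈e a′∉e (sym ca≡ca′)
        a∉e₁ : a ∉ exchange a a′ e
        a∉e₁ a∈e₁ = [ a≢a′ , (λ (_ , a≢a) → a≢a refl) ]′ (∈-exchange⁻ a′∉e a∈e₁)

    H′-covering : Covering H′ K
    H′-covering S ∣S∣≡K with cov S ∣S∣≡K
    ... | e , e∈H , e⊆S with split e in eq
    ... | false = e , σ-∈ e∈H (switch-false t split eq) , e⊆S
    ... | true with split-true⁻ Q₀ eq
    ... | Q , a∈e , a′∉e , _ = split-covers Q ∣S∣≡K e∈H e⊆S a∈e a′∉e

    H⇒H′ : ∀ {u w} → Adj H u w → Connected H′ u w
    H⇒H′ (e , e∈H , u∈e , w∈e) with split e in eq
    ... | false = adj⇒connected H′ (σ-∈ e∈H (switch-false t split eq)) u∈e w∈e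
    ... | true with split-true⁻ Q₀ eq
    ... | Q , a∈e , a′∉e , _ = split-connected Q e∈H a∈e a′∉e u∈e w∈e

    H′⇒c : ∀ {u w} → Adj H′ u w → c u ≡ c w ⊎ (Involved Q₀ u × Involved Q₀ w)
    H′⇒c (e′ , e′∈H′ , u∈e′ , w∈e′) with ∈-map⁻ σ e′∈H′
    ... | e , e∈H , refl with split e in eq
    ... | false = inj₁ (mono e∈H u∈e′ w∈e′)
    ... | true with split-true⁻ Q₀ eq
    ... | Q , a∈e , a′∉e , a-inv , b-inv = inj₂ (involved u∈e′ , involved w∈e′)
      where
      involved : ∀ {x} → x ∈ preimage t e → Involved Q₀ x
      involved x∈ with ∈-switched⁻ Q e∈H a∈e a′∉e x∈
      ... | inj₁ refl = b-inv
      ... | inj₂ (x∈e , _) = subst (λ i → i ≡ c (Quad.a Q₀) ⊎ i ≡ c (Quad.b Q₀)) (mono e∈H a∈e x∈e) a-inv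

  -- The edge `e` is split: it trades `a` for `b` but keeps some `z` from the component of `a`, and
  -- thereby joins the two components.
  switch-reducible : ∀ {e} → e ∈ˡ edges H → Quad.a Q₀ ∈ e → Quad.a′ Q₀ ∉ e → Reducible K m H
  switch-reducible {e} e∈H a∈e a′∉e
    with two-more (subst (3 ≤_) (sym (All.lookup (uniform H) e∈H)) 3≤r) a∈e
  ... | z , _ , z∈e , _ , z≢a , _ = H′ , (H′-components , H′-covering) ,
    ≤-reflexive (length-map σ (edges H))
    where
    open Quad Q₀
    z~b : Connected H′ z b
    z~b = adj⇒connected H′ (switched-edge Q₀ e∈H a∈e a′∉e) (∈-switched⁺ Q₀ e∈H a∈e a′∉e z∈e z≢a)
      (∈-preimage⁺ t (subst (_∈ e) (sym tb) a∈e))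
    cz≡ca : c z ≡ c a
    cz≡ca = mono e∈H z∈e a∈e
    H′-components : HasComponents H′ m
    H′-components = merge-components H H′ comps z b (λ eq → ca≢cb (trans (sym cz≡ca) eq)) z~b H⇒H′
      (subst (λ i → ∀ {u w} → Adj H′ u w → c u ≡ c w ⊎ ((c u ≡ i ⊎ c u ≡ c b) × (c w ≡ i ⊎ c w ≡ c b)))
        (sym cz≡ca) H′⇒c)

-- Adding w to the union of s-subsets of the edges, one for each component, leaves room for only one
-- possible edge, so the covering condition forces every component to be complete.
module _ {s n k} (H : RGraph (suc s) n) (comps : HasComponents H k) (cov : Covering H (s * k + 1))
  (covered : ∀ v → ∃ λ e → e ∈ˡ edges H × v ∈ e) where

  private
    c : Fin n → Fin k
    c = proj₁ comps

    mono : Monochromatic H c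
    mono = components-monochromatic H comps

  representative : Fin k → Fin n
  representative j = proj₁ (proj₁ (proj₂ comps) j)

  c-representative : ∀ j → c (representative j) ≡ j
  c-representative j = proj₂ (proj₁ (proj₂ comps) j)

  edge-of : Fin k → Subset n
  edge-of j = proj₁ (covered (representative j))

  edge-of∈H : ∀ j → edge-of j ∈ˡ edges H
  edge-of∈H j = proj₁ (proj₂ (covered (representative j)))

  representative∈ : ∀ j → representative j ∈ edge-of j
  representative∈ j = proj₂ (proj₂ (covered (representative j)))

  edge-of-colour : ∀ j {x} → x ∈ edge-of j → c x ≡ j
  edge-of-colour j x∈ = trans (mono (edge-of∈H j) x∈ (representative∈ j)) (c-representative j)

  -- Otherwise the chosen edges, one per component, would exhaust the vertex set. The vertex found
  -- lies in a component with more than r vertices.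
  outside-vertex : n ≢ k * suc s → ∃ λ w → w ∉ edge-of (c w)
  outside-vertex n≢ with any? (λ w → ¬? (w ∈? edge-of (c w)))
  ... | yes found = found
  ... | no none = contradiction (trans (sym (∣⊤∣≡n n)) (trans (cong ∣_∣ (sym transversal≡⊤)) size)) n≢
    where
    ∣edge-of∣ : ∀ j → ∣ edge-of j ∣ ≡ suc s
    ∣edge-of∣ j = All.lookup (uniform H) (edge-of∈H j)
    size : ∣ transversal c edge-of ∣edge-of∣ edge-of-colour ∣ ≡ k * suc s
    size = ∣transversal∣ c edge-of ∣edge-of∣ edge-of-colour
    transversal≡⊤ : transversal c edge-of ∣edge-of∣ edge-of-colour ≡ ⊤
    transversal≡⊤ = ⊆-antisym ⊆⊤ λ {x} _ → ∈-transversal⁺ c edge-of ∣edge-of∣ edge-of-colour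
      (case x ∈? edge-of (c x) of λ where
        (yes x∈) → x∈
        (no x∉) → contradiction (x , x∉) none)

  exchange-closed : ExchangeClosed H c
  exchange-closed {e} {u} {w} e∈H u∈e w∉e cw≡cu = found
    where
    ∣edge-x∣ : ∀ {e x} → e ∈ˡ edges H → x ∈ e → ∣ e - x ∣ ≡ s
    ∣edge-x∣ e∈H x∈e = suc-injective (trans (∣p-x∣+1 x∈e) (All.lookup (uniform H) e∈H))

    -- In the component of `u` the `s` vertices are those of `e - u`, so that after adding `w` the
    -- only candidate for an edge is e - u + w.
    part : ∀ j → Dec (c u ≡ j) → Subset n
    part j (yes _) = e - u
    part j (no _) = edge-of j - representative j

    T : Fin k → Subset n
    T j = part j (c u ≟ j)

    ∣T∣ : ∀ j → ∣ T j ∣ ≡ s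
    ∣T∣ j with c u ≟ j
    ... | yes _ = ∣edge-x∣ e∈H u∈e
    ... | no _ = ∣edge-x∣ (edge-of∈H j) (representative∈ j)

    T-colour : ∀ j {x} → x ∈ T j → c x ≡ j
    T-colour j x∈ with c u ≟ j
    ... | yes cu≡j = trans (mono e∈H (p-x⊆p x∈) u∈e) cu≡j
    ... | no _ = edge-of-colour j (p-x⊆p x∈)

    T-own : ∀ {j x} → c u ≡ j → x ∈ T j → x ∈ e - u
    T-own {j} cu≡j x∈ with c u ≟ j
    ... | yes _ = x∈
    ... | no cu≢j = contradiction cu≡j cu≢j

    U : Subset n
    U = transversal c T ∣T∣ T-colour

    ∈U⁻ : ∀ {x} → x ∈ U → x ∈ T (c x)
    ∈U⁻ = ∈-transversal⁻ c T ∣T∣ T-colour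

    w∉U : w ∉ U
    w∉U w∈U = w∉e (p-x⊆p (T-own (sym cw≡cu) (∈U⁻ w∈U)))

    ∣U∪w∣ : ∣ U ∪ ⁅ w ⁆ ∣ ≡ s * k + 1
    ∣U∪w∣ = trans (∣p∪⁅x⁆∣ w∉U) (trans (cong suc (∣transversal∣ c T ∣T∣ T-colour))
      (trans (cong suc (*-comm k s)) (+-comm 1 (s * k))))

    -- An edge lies in one component, where `U` has only `s` vertices.
    no-edge-in-U : ∀ {g} → g ∈ˡ edges H → ¬ g ⊆ U
    no-edge-in-U {g} g∈H g⊆U
      with ∣p∣>0⇒nonempty g (subst (1 ≤_) (sym (All.lookup (uniform H) g∈H)) (s≤s z≤n))
    ... | x , x∈g = <-irrefl refl (subst (suc s ≤_) (∣T∣ (c x)) (subst (_≤ ∣ T (c x) ∣)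
      (All.lookup (uniform H) g∈H)
      (p⊆q⇒∣p∣≤∣q∣ λ y∈g → subst (λ j → _ ∈ T j) (mono g∈H y∈g x∈g) (∈U⁻ (g⊆U y∈g)))))

    ∈U∪w⁻ : ∀ {x} → x ∈ U ∪ ⁅ w ⁆ → x ∈ U ⊎ x ≡ w
    ∈U∪w⁻ x∈ with x∈p∪q⁻ U ⁅ w ⁆ x∈
    ... | inj₁ x∈U = inj₁ x∈U
    ... | inj₂ x∈w = inj₂ (x∈⁅y⁆⇒x≡y w x∈w)

    found : exchange u w e ∈ˡ edges H
    found with cov (U ∪ ⁅ w ⁆) ∣U∪w∣
    ... | g , g∈H , g⊆ with w ∈? g
    ... | no w∉g = contradiction (λ {x} → g⊆U {x}) (no-edge-in-U g∈H)
      where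
      g⊆U : g ⊆ U
      g⊆U x∈g = [ id , (λ { refl → contradiction x∈g w∉g }) ]′ (∈U∪w⁻ (g⊆ x∈g))
    ... | yes w∈g = subst (_∈ˡ edges H) (⊆∧∣q∣≤∣p∣⇒≡ g⊆exchange (≤-reflexive
      (trans (∣exchange∣ u w e) (trans (All.lookup (uniform H) e∈H) (sym (All.lookup (uniform H) g∈H)))))) g∈H
      where
      g⊆exchange : g ⊆ exchange u w e
      g⊆exchange x∈g with ∈U∪w⁻ (g⊆ x∈g)
      ... | inj₂ refl = ∈-exchange-new u∈e
      ... | inj₁ x∈U = ∈-exchange-old (p-x⊆p x∈e-u) (λ { refl → x∉p-x e x∈e-u }) w∉e
        where
        x∈e-u : _ ∈ e - u
        x∈e-u = T-own (sym (trans (mono g∈H x∈g w∈g) cw≡cu)) (∈U⁻ x∈U)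

-- The quad has `a′` = `w`, a vertex outside the chosen edge of its own component, and `a` the
-- representative on that edge; `b` and `b′` come from the chosen edge of another component.
no-isolated-reducible : ∀ {s n m} → 2 ≤ s → (H : RGraph (suc s) n) (comps : HasComponents H (suc (suc m))) →
  Covering H (s * suc (suc m) + 1) → n ≢ suc (suc m) * suc s →
  (∀ v → ∃ λ e → e ∈ˡ edges H × v ∈ e) → Reducible (s * suc (suc m) + 1) (suc m) H
no-isolated-reducible {s} {n} {m} 2≤s H comps cov n≢ covered
  with outside-vertex H comps cov covered n≢
... | w , w∉ with another (subst (3 ≤_) (sym (All.lookup (uniform H)
  (edge-of∈H H comps cov covered (punchIn (proj₁ comps w) zero)))) (s≤s 2≤s))
  (representative∈ H comps cov covered (punchIn (proj₁ comps w) zero))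
... | b′ , b′∈ , b′≢b = switch-reducible (s≤s 2≤s) H comps cov (exchange-closed H comps cov covered)
  (quad c (∈-≢ (representative∈ H comps cov covered i) w∉) (b′≢b ∘ sym)
    (c-representative H comps cov covered i)
    (trans (c-representative H comps cov covered j) (sym (edge-of-colour H comps cov covered j b′∈)))
    λ eq → punchInᵢ≢i i zero (sym (trans (sym (c-representative H comps cov covered i))
      (trans eq (c-representative H comps cov covered j)))))
  (edge-of∈H H comps cov covered i) (representative∈ H comps cov covered i) w∉
  where
  c = proj₁ comps
  i = c w
  j = punchIn i zero

-- The two cases, numerical bounds and the theorem

reducible : ∀ {s n m} → 2 ≤ s →
  s * suc (suc m) + 1 + (s * suc (suc m) ∸ 1) C s ≤ n → (H : RGraph (suc s) n) →
  Admissible (s * suc (suc m) + 1) (suc (suc m)) H → Reducible (s * suc (suc m) + 1) (suc m) H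
reducible {s@(suc s′)} {n} {m} 2≤s n-large H (comps , cov)
  with any? (λ v → All.all? (λ e → ¬? (v ∈? e)) (edges H))
... | yes (v , isolated) = isolated-reducible H comps cov v isolated
  (close-pair 2≤s H v isolated (subst (λ K → K + (s * suc (suc m) ∸ 1) C s ≤ n) K≡ n-large)
    (subst (Covering H) K≡ cov))
  where
  -- As `s` is positive, subtracting 1 from the product truncates nothing.
  K≡ : s * suc (suc m) + 1 ≡ suc (suc (s * suc (suc m) ∸ 1))
  K≡ = +-comm (s * suc (suc m)) 1
... | no none = no-isolated-reducible 2≤s H comps cov (λ { refl → <-irrefl refl n-strict }) covered
  where
  open ≤-Reasoning
  covered : ∀ v → ∃ λ e → e ∈ˡ edges H × v ∈ e
  covered v with Any.any? (v ∈?_) (edges H)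
  ... | yes found = find found
  ... | no ¬found = contradiction (v , All.¬Any⇒All¬ (edges H) ¬found) none

  k = suc (suc m)
  -- Chosen so that d + s = sk - 1, while d + 1 = s(k-1) ≥ 2(k-1) ≥ k.
  d = s * suc m ∸ 1

  k≤C : k ≤ (s * k ∸ 1) C s
  k≤C = begin
    suc (suc m)          ≤⟨ s≤s (m≤n+m (suc m) m) ⟩
    suc m + suc m        ≡⟨ cong (suc m +_) (sym (*-identityˡ (suc m))) ⟩
    2 * suc m            ≤⟨ *-mono-≤ 2≤s (≤-refl {suc m}) ⟩
    suc d                ≤⟨ d<[d+j]Cj d s (s≤s z≤n) ⟩
    (d + s) C s          ≡⟨ cong (_C s) (sym d+s≡) ⟩
    (s * k ∸ 1) C s      ∎
    where
    d+s≡ : s * k ∸ 1 ≡ d + s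
    d+s≡ = cong (_∸ 1) (trans (*-suc s (suc m)) (trans (+-suc s d) (cong suc (+-comm s d))))

  n-strict : k * suc s < n
  n-strict = begin-strict
    k * suc s                    ≡⟨ *-suc k s ⟩
    k + k * s                    ≡⟨ trans (+-comm k (k * s)) (cong (_+ k) (*-comm k s)) ⟩
    s * k + k                    <⟨ ≤-reflexive (trans (sym (+-suc (s * k) k)) (sym (+-assoc (s * k) 1 k))) ⟩
    s * k + 1 + k                ≤⟨ +-monoʳ-≤ (s * k + 1) k≤C ⟩
    s * k + 1 + (s * k ∸ 1) C s  ≤⟨ n-large ⟩
    n                            ∎

theorem1p2 : ∀ (r k n : ℕ) → 3 ≤ r → 2 ≤ k →
    (r ∸ 1) * k + 1 + (((r ∸ 1) * k ∸ 1) C (r ∸ 1)) ≤ n → k ∣ n →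
    ∃ λ m → 1 ≤ m × m < k ×
    (∀ (tk tm : ℕ) → IsT r n ((r ∸ 1) * k + 1) k tk → IsT r n ((r ∸ 1) * k + 1) m tm → tm ≤ tk)
theorem1p2 (suc s) (suc (suc m)) n (s≤s 2≤s) (s≤s (s≤s _)) n-large _ =
  suc m , s≤s z≤n , ≤-refl , bound
  where
  bound : ∀ tk tm → IsT (suc s) n (s * suc (suc m) + 1) (suc (suc m)) tk →
    IsT (suc s) n (s * suc (suc m) + 1) (suc m) tm → tm ≤ tk
  bound tk tm ((H , adm , refl) , _) (_ , tm-least) with reducible 2≤s n-large H adm
  ... | H′ , adm′ , H′≤H = ≤-trans (tm-least H′ adm′) H′≤H
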